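{- For every formula $\varphi\in\mathcal{L}_{K,\Box,B}$, the formula $B\varphi\leftrightarrow K\Diamond\Box\varphi$ is provable in $\mathsf{SEL}_{K,\Box,B}$.
   Context: Language. Fix a countable set PROP of primitive propositions. $\mathcal{L}_{K,\Box,B}$ is generated by $\varphi ::= p \mid \neg\varphi \mid \varphi\wedge\psi \mid K\varphi\mid\Box\varphi\mid B\varphi$, $p\in$ PROP. The connectives $\vee,\to,\leftrightarrow$ are defined as usual and $\Diamond := \neg\Box\neg$. The logic $\mathsf{EL}_{K,\Box}$ is the Hilbert system consisting of classical propositional logic (with modus ponens) plus: the $\mathsf{S5}$ principles for $K$: $K(\varphi\to\psi)\to(K\varphi\to K\psi)$, $K\varphi\to\varphi$, $K\varphi\to KK\varphi$, $\neg K\varphi\to K\neg K\varphi$, and the rule "from $\vdash\varphi$ infer $\vdash K\varphi$"; the $\mathsf{S4}$ principles for $\Box$: $\Box(\varphi\to\psi)\to(\Box\varphi\to\Box\psi)$, $\Box\varphi\to\varphi$, $\Box\varphi\to\Box\Box\varphi$, and the rule "from $\vdash\varphi$ infer $\vdash\Box\varphi$"; the scheme $(\mathrm{KI})$ $K\varphi\to\Box\varphi$. The logic $\mathsf{SEL}_{K,\Box,B}$ is $\mathsf{EL}_{K,\Box}$ (all schemes and rules now ranging over formulas of $\mathcal{L}_{K,\Box,B}$) plus the axiom schemes: $(\mathrm{K}_B)$ $B(\varphi\to\psi)\to(B\varphi\to B\psi)$; $(\mathrm{sPI})$ $B\varphi\to KB\varphi$; $(\mathrm{KB})$ $K\varphi\to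 B\varphi$; $(\mathrm{RB})$ $B\varphi\to B\Box\varphi$; $(\mathrm{wF})$ $B\varphi\to\Diamond\varphi$; $(\mathrm{CB})$ $B(\Box\varphi\vee\Box\neg\Box\varphi)$. -}

module Defs where

open import Data.Bool using (Bool; true; not) renaming (_∧_ to _&&_)
open import Relation.Binary.PropositionalEquality using (_≡_)

infix  9 ‵_
infix  8 ~_ K_ □_ B_ ◇_
infixr 7 _∧_
infixr 6 _∨_
infixr 5 _⇒_
infix  4 _⇔_
infix  2 _⊢_

data Formula (PROP : Set) : Set where
  ‵_  : PROP → Formula PROP
  ~_  : Formula PROP → Formula PROP
  _∧_ : Formula PROP → Formula PROP → Formula PROP
  K_  : Formula PROP → Formula PROP
  □_  : Formula PROP → Formula PROP
  B_  : Formula PROP → Formula PROP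

private
  variable
    PROP : Set
    φ ψ  : Formula PROP

_∨_ : Formula PROP → Formula PROP → Formula PROP
φ ∨ ψ = ~ (~ φ ∧ ~ ψ)

_⇒_ : Formula PROP → Formula PROP → Formula PROP
φ ⇒ ψ = ~ (φ ∧ ~ ψ)

_⇔_ : Formula PROP → Formula PROP → Formula PROP
φ ⇔ ψ = (φ ⇒ ψ) ∧ (ψ ⇒ φ)

◇_ : Formula PROP → Formula PROP
◇ φ = ~ (□ (~ φ))

-- Truth-functional evaluation: primitive propositions and formulas whose main
-- operator is K, □ or B are atoms, valued by v.  The values of v at negations
-- and conjunctions are never used.
eval : (Formula PROP → Bool) → Formula PROP → Bool
eval v (~ φ)   = not (eval v φ)
eval v (φ ∧ ψ) = eval v φ && eval v ψ
eval v (‵ p)   = v (‵ p)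
eval v (K φ)   = v (K φ)
eval v (□ φ)   = v (□ φ)
eval v (B φ)   = v (B φ)

-- Equivalently, the substitution instances of propositional tautologies.
Tautology : Formula PROP → Set
Tautology {PROP} φ = (v : Formula PROP → Bool) → eval v φ ≡ true

data EL-Axiom {PROP : Set} : Formula PROP → Set where
  taut : Tautology φ → EL-Axiom φ

  K-K  : EL-Axiom (K (φ ⇒ ψ) ⇒ (K φ ⇒ K ψ))
  K-T  : EL-Axiom (K φ ⇒ φ)
  K-4  : EL-Axiom (K φ ⇒ K K φ)
  K-5  : EL-Axiom (~ K φ ⇒ K ~ K φ)

  □-K  : EL-Axiom (□ (φ ⇒ ψ) ⇒ (□ φ ⇒ □ ψ))
  □-T  : EL-Axiom (□ φ ⇒ φ)
  □-4  : EL-Axiom (□ φ ⇒ □ □ φ)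

  KI   : EL-Axiom (K φ ⇒ □ φ)

data SEL-Axiom {PROP : Set} : Formula PROP → Set where
  el   : EL-Axiom φ → SEL-Axiom φ
  K-B  : SEL-Axiom (B (φ ⇒ ψ) ⇒ (B φ ⇒ B ψ))
  sPI  : SEL-Axiom (B φ ⇒ K B φ)
  KB   : SEL-Axiom (K φ ⇒ B φ)
  RB   : SEL-Axiom (B φ ⇒ B □ φ)
  wF   : SEL-Axiom (B φ ⇒ ◇ φ)
  CB   : SEL-Axiom (B (□ φ ∨ □ ~ □ φ))

-- No premises: necessitation applies to theorems only.
data _⊢_ {PROP : Set} (Ax : Formula PROP → Set) : Formula PROP → Set where
  axiom : Ax φ → Ax ⊢ φ
  mp    : Ax ⊢ φ ⇒ ψ → Ax ⊢ φ → Ax ⊢ ψ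
  nec-K : Ax ⊢ φ → Ax ⊢ K φ
  nec-□ : Ax ⊢ φ → Ax ⊢ □ φ

{-# OPTIONS --safe #-}

-- Left to right, RB and wF give Bφ ⇒ ◇□φ, and sPI lets K be put in front.
-- Right to left, KB turns K◇□φ into B◇□φ.  Since ◇□φ is the negation of the
-- second disjunct in CB, disjunctive syllogism under B yields B□φ, hence Bφ.
module Submission where

open import Defs
open import Data.Bool using (true; false)
open import Data.Nat using (ℕ)
open import Function.Bundles using (_↣_)
open import Relation.Binary.PropositionalEquality using (refl)

private
  variable
    PROP  : Set
    φ ψ χ : Formula PROP

-- `eval` commutes with `~` and `∧`, so the goal is a Boolean expression in three values. As `_&&_`
-- matches on its first argument, `χ` has to be split only when `ψ` is true.
⇒-trans-tautology : (φ ψ χ : Formula PROP) → Tautology ((φ ⇒ ψ) ⇒ (ψ ⇒ χ) ⇒ (φ ⇒ χ))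
⇒-trans-tautology φ ψ χ v with eval v φ | eval v ψ | eval v χ
... | false | false | _     = refl
... | false | true  | false = refl
... | false | true  | true  = refl
... | true  | false | _     = refl
... | true  | true  | false = refl
... | true  | true  | true  = refl

∧-intro-tautology : (φ ψ : Formula PROP) → Tautology (φ ⇒ ψ ⇒ φ ∧ ψ)
∧-intro-tautology φ ψ v with eval v φ | eval v ψ
... | false | _     = refl
... | true  | false = refl
... | true  | true  = refl

∨-syllogism-tautology : (φ ψ : Formula PROP) → Tautology (φ ∨ ψ ⇒ ~ ψ ⇒ φ)
∨-syllogism-tautology φ ψ v with eval v φ | eval v ψ
... | false | false = refl
... | false | true  = refl
... | true  | false = refl
... | true  | true  = refl

tautology : Tautology φ → SEL-Axiom ⊢ φ
tautology t = axiom (el (taut t))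

infixr 4 _⨾_

_⨾_ : SEL-Axiom ⊢ φ ⇒ ψ → SEL-Axiom ⊢ ψ ⇒ χ → SEL-Axiom ⊢ φ ⇒ χ
_⨾_ {φ = φ} {ψ = ψ} {χ = χ} p q =
  mp (mp (tautology (⇒-trans-tautology φ ψ χ)) p) q

∧-intro : SEL-Axiom ⊢ φ → SEL-Axiom ⊢ ψ → SEL-Axiom ⊢ φ ∧ ψ
∧-intro {φ = φ} {ψ = ψ} p q = mp (mp (tautology (∧-intro-tautology φ ψ)) p) q

K-mono : SEL-Axiom ⊢ φ ⇒ ψ → SEL-Axiom ⊢ K φ ⇒ K ψ
K-mono p = mp (axiom (el K-K)) (nec-K p)

-- `B` has no primitive necessitation rule; it inherits that of `K` through `KB`.
nec-B : SEL-Axiom ⊢ φ → SEL-Axiom ⊢ B φ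
nec-B p = mp (axiom KB) (nec-K p)

B-mono : SEL-Axiom ⊢ φ ⇒ ψ → SEL-Axiom ⊢ B φ ⇒ B ψ
B-mono p = mp (axiom K-B) (nec-B p)

B⇒K◇□ : (φ : Formula PROP) → SEL-Axiom ⊢ B φ ⇒ K ◇ □ φ
-- `wF` is taken at `□ φ`, so that it composes with `RB` into a theorem, which may go under `K`.
B⇒K◇□ φ = axiom sPI ⨾ K-mono (axiom RB ⨾ axiom wF)

B◇□⇒B□ : (φ : Formula PROP) → SEL-Axiom ⊢ B ◇ □ φ ⇒ B □ φ
B◇□⇒B□ φ =
  mp (axiom K-B)
     -- `◇ □ φ` unfolds to `~ □ ~ □ φ`, so the second premise of the syllogism matches it
     -- definitionally, even under `B`.
     (mp (B-mono (tautology (∨-syllogism-tautology (□ φ) (□ ~ □ φ)))) (axiom CB))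

K◇□⇒B : (φ : Formula PROP) → SEL-Axiom ⊢ K ◇ □ φ ⇒ B φ
K◇□⇒B φ = axiom KB ⨾ B◇□⇒B□ φ ⨾ B-mono (axiom (el □-T))

proposition3 : (PROP : Set) → PROP ↣ ℕ → (φ : Formula PROP) → SEL-Axiom ⊢ (B φ ⇔ K ◇ □ φ)
proposition3 PROP _ φ = ∧-intro (B⇒K◇□ φ) (K◇□⇒B φ)
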